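{- Let $(S,<)$ be a well-founded partially ordered set. Then the Star Hydra rewrite relation $\to_{\mathit{SH}}$ on finite trees with nodes labeled from $S$ is terminating: there is no infinite sequence $h_0\to_{\mathit{SH}}h_1\to_{\mathit{SH}}h_2\to_{\mathit{SH}}\cdots$.
   Context: Trees are finite, rooted and unordered; $n(t_1,\ldots,t_k)$ ($k\ge0$) denotes the tree with root label $n$ and immediate subtrees $t_1,\ldots,t_k$, the order of arguments being irrelevant; a leaf labeled $\alpha$ is written $\alpha$. A Star Hydra is a finite tree with nodes labeled from $S$. For every $s\in S$ let $\underline{s}$ be a fresh symbol and $\underline{S}=\{\underline{s}\mid s\in S\}$. On finite trees labeled with $S\cup\underline{S}$ consider the following rewrite rules, applicable at any subtree, where $n,m,\alpha,\beta_i\in S$ and $\vec x,\vec y$ stand for arbitrary finite (possibly empty) sequences of trees: (chop) $n(\alpha,\vec x)\to\underline{n}(\underline{\beta_1},\ldots,\underline{\beta_k},\vec x)$ for $k\ge0$ and $\beta_1,\ldots,\beta_k<\alpha$ (here $\alpha$ and the $\underline{\beta_i}$ are leaves); (propagate) $n(\underline{m}(\vec x),\vec y)\to\underline{n}(\underline{m}(\vec x),\vec y)$; (widen) $\underline{n}(\underline{m}(\vec x),\vec y)\to\underline{n}(\underline{m}(\vec x),\ldots,\underline{m}(\vec x),\vec y)$ with $0$ or more copies of $\underline{m}(\vec x)$ on the right; (lengthen) $\underline{n}(\vec x)\to\underline{m}(\underline{n}(\vec x))$ if $m<n$; (waive) $\underline{m}(\vec x)\to m(\vec x)$. The Star Hydra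 rewrite relation on trees labeled from $S$ is the composition $$\to_{\mathit{SH}}\;=\;\to_{\mathrm{chop}}\cdot\to_{\mathrm{propagate}}^!\cdot(\to_{\mathrm{widen}}\cup\to_{\mathrm{lengthen}})^*\cdot\to_{\mathrm{waive}}^!,$$ where compositions are read left to right, and $R^!$ denotes a maximal reduction: $x\mathrel{R^!}y$ iff $x\mathrel{R^*}y$ and there is no $z$ with $y\mathrel{R}z$. -}

module Defs where

open import Data.List.Base using (List; []; _∷_; _++_; map; replicate)
open import Data.List.Relation.Binary.Permutation.Homogeneous as Perm
  using (Permutation)
open import Data.List.Relation.Binary.Pointwise.Base using (Pointwise; []; _∷_)
open import Data.List.Relation.Unary.All using (All)
open import Data.Nat.Base using (ℕ)
open import Data.Product.Base using (_×_)
open import Level using (Level; _⊔_)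
open import Relation.Binary.Construct.Closure.ReflexiveTransitive using (Star)
open import Relation.Binary.Construct.Composition using (_;_)
open import Relation.Binary.Construct.Union using (_∪_)
open import Relation.Binary.Core using (Rel)
open import Relation.Binary.PropositionalEquality.Core using (_≡_; refl; sym; trans)
open import Relation.Binary.Rewriting using (IsNormalForm)
open import Relation.Binary.Structures using (IsEquivalence)

data Tree {a} (A : Set a) : Set a where
  node : A → List (Tree A) → Tree A

leaf : ∀ {a} {A : Set a} → A → Tree A
leaf x = node x []

mutual
  mapTree : ∀ {a b} {A : Set a} {B : Set b} → (A → B) → Tree A → Tree B
  mapTree f (node x ts) = node (f x) (mapForest f ts)

  mapForest : ∀ {a b} {A : Set a} {B : Set b} →
              (A → B) → List (Tree A) → List (Tree B)
  mapForest f []       = []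
  mapForest f (t ∷ ts) = mapTree f t ∷ mapForest f ts

module _ {a} {A : Set a} where

  infix 4 _≈_

  -- Unordered trees are ordered trees considered up to ≈: children may be
  -- permuted at every node.
  data _≈_ : Rel (Tree A) a where
    node : ∀ {x y ts us} → x ≡ y → Permutation _≈_ ts us → node x ts ≈ node y us

  mutual
    ≈-refl : ∀ {t} → t ≈ t
    ≈-refl {node x ts} = node refl (Perm.refl ≈-reflⁿ)

    ≈-reflⁿ : ∀ {ts} → Pointwise _≈_ ts ts
    ≈-reflⁿ {[]}     = []
    ≈-reflⁿ {t ∷ ts} = ≈-refl ∷ ≈-reflⁿ

  mutual
    ≈-sym : ∀ {t u} → t ≈ u → u ≈ t
    ≈-sym (node x≡y p) = node (sym x≡y) (≈-symᵖ p)

    ≈-symᵖ : ∀ {ts us} → Permutation _≈_ ts us → Permutation _≈_ us ts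
    ≈-symᵖ (Perm.refl ps)    = Perm.refl (≈-symⁿ ps)
    ≈-symᵖ (Perm.prep e p)   = Perm.prep (≈-sym e) (≈-symᵖ p)
    ≈-symᵖ (Perm.swap e f p) = Perm.swap (≈-sym f) (≈-sym e) (≈-symᵖ p)
    ≈-symᵖ (Perm.trans p q)  = Perm.trans (≈-symᵖ q) (≈-symᵖ p)

    ≈-symⁿ : ∀ {ts us} → Pointwise _≈_ ts us → Pointwise _≈_ us ts
    ≈-symⁿ []       = []
    ≈-symⁿ (p ∷ ps) = ≈-sym p ∷ ≈-symⁿ ps

  ≈-trans : ∀ {t u v} → t ≈ u → u ≈ v → t ≈ v
  ≈-trans (node x≡y p) (node y≡z q) = node (trans x≡y y≡z) (Perm.trans p q)

  ≈-isEquivalence : IsEquivalence _≈_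
  ≈-isEquivalence = record { refl = ≈-refl ; sym = ≈-sym ; trans = ≈-trans }

  module _ {r} (R : Rel (Tree A) r) where

    data AtSubtree : Rel (Tree A) (a ⊔ r) where
      here  : ∀ {t u} → R t u → AtSubtree t u
      -- Up to ≈, the rewritten child may be taken to be the first one.
      below : ∀ {x t u ts} → AtSubtree t u →
              AtSubtree (node x (t ∷ ts)) (node x (u ∷ ts))

    -- One application of the rule R at some subtree of an unordered tree.
    Rewrite : Rel (Tree A) (a ⊔ r)
    Rewrite = _≈_ ; AtSubtree ; _≈_

    -- R* on unordered trees: its reflexive part is ≈, not just ≡.
    Reduce : Rel (Tree A) (a ⊔ r)
    Reduce = Star R ; _≈_

    -- R!
    Reduce! : Rel (Tree A) (a ⊔ r)
    Reduce! t u = Reduce t u × IsNormalForm R u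

-- The disjoint union of S and its underlined copy.
data Label {a} (S : Set a) : Set a where
  plain underlined : S → Label S

module StarHydra {a ℓ} {S : Set a} (_<_ : Rel S ℓ) where

  data ChopRule : Rel (Tree (Label S)) (a ⊔ ℓ) where
    chop : ∀ {n α βs xs} → All (_< α) βs →
           ChopRule (node (plain n) (leaf (plain α) ∷ xs))
                    (node (underlined n) (map (λ β → leaf (underlined β)) βs ++ xs))

  data PropagateRule : Rel (Tree (Label S)) a where
    propagate : ∀ {n m xs ys} →
                PropagateRule (node (plain n) (node (underlined m) xs ∷ ys))
                              (node (underlined n) (node (underlined m) xs ∷ ys))

  data WidenRule : Rel (Tree (Label S)) a where
    widen : ∀ {n m xs ys} (k : ℕ) →
            WidenRule (node (underlined n) (node (underlined m) xs ∷ ys))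
                      (node (underlined n) (replicate k (node (underlined m) xs) ++ ys))

  data LengthenRule : Rel (Tree (Label S)) (a ⊔ ℓ) where
    lengthen : ∀ {n m xs} → m < n →
               LengthenRule (node (underlined n) xs)
                            (node (underlined m) (node (underlined n) xs ∷ []))

  data WaiveRule : Rel (Tree (Label S)) a where
    waive : ∀ {m xs} → WaiveRule (node (underlined m) xs) (node (plain m) xs)

  infix 4 _⟶SH_

  _⟶SH_ : Rel (Tree S) (a ⊔ ℓ)
  h ⟶SH h′ = step (mapTree plain h) (mapTree plain h′)
    where
    step : Rel (Tree (Label S)) (a ⊔ ℓ)
    step = Rewrite ChopRule
         ; Reduce! (Rewrite PropagateRule)
         ; Reduce (Rewrite WidenRule ∪ Rewrite LengthenRule)
         ; Reduce! (Rewrite WaiveRule)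

{-# OPTIONS --safe #-}
module Submission where

-- Every Star Hydra step is a decrease in a multiset path order.  Call a node
-- marked if its label is underlined.  Let ≻ be the relation on marked trees that
-- compares labels with the marks erased, where s ≻ t holds if
--   * the root of t is smaller than that of s and s dominates every child of
--     t, or
--   * the roots agree and the children of t arise from those of s by replacing
--     a single child a by finitely many trees, each dominated by a.
-- Replacing only one child is enough: the nodes above a chopped leaf form a
-- path, so each of them has only one child in which anything changes.
--
-- A chop decreases its tree (AtSubtree-chop).  Afterwards the trees of a Star
-- Hydra step need not decrease one after the other, as widening copies
-- subtrees.  What is kept instead is that the unmarked tree s at the beginning
-- of the step satisfies s ≻ u for every later tree u.  If v is a subtree of u
-- with a marked node, then the derivation of s ≻ u contains a comparison t ≻ v
-- with an unmarked subtree t of s, and in that derivation v may be replaced by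
-- any trees dominated by t (replace-child): by copies of v, or by v put below a
-- smaller label.  Hence s ⟶SH t entails s ≻ t (⟶SH⇒≻).
--
-- Well-foundedness of ≻ (≻-wellFounded) has the usual inductive proof for path
-- orders: a tree with accessible children is accessible, by induction on the
-- root label, then on the multiset of children, then on the derivation of the
-- comparison.  The second induction uses that the multiset extension preserves
-- accessibility (∈-acc⇒acc).  No decidability or totality of the order on
-- labels is needed.

open import Defs
open import Data.List.Base using (List; []; _∷_; _++_; map; replicate)
open import Data.List.Relation.Unary.All using (All; []; _∷_)
open import Data.List.Relation.Unary.Any using (here; there)
import Data.List.Membership.Setoid as Membership
import Data.List.Membership.Setoid.Properties as Membershipₚ
import Data.List.Relation.Binary.Permutation.Setoid as Permutation
import Data.List.Relation.Binary.Permutation.Setoid.Properties as Permutationₚ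
open import Data.Nat.Base using (ℕ; suc)
open import Data.Product.Base using (Σ-syntax; ∃-syntax; _×_; _,_)
open import Data.Sum.Base using (_⊎_; [_,_]′)
open import Function.Base using (_∘_; flip)
open import Induction.WellFounded using (Acc; acc; acc-inverse; Acc-resp-flip-≈; WellFounded)
open import Level using (_⊔_)
open import Relation.Binary.Bundles using (Setoid)
open import Relation.Binary.Construct.Closure.ReflexiveTransitive using (Star; ε; _◅_)
open import Relation.Binary.Core using (Rel)
open import Relation.Binary.Definitions using (Transitive; _Respects_; _Respectsˡ_; _Respectsʳ_)
open import Relation.Binary.PropositionalEquality.Core using (_≡_; refl; sym; trans; subst)
open import Relation.Binary.Structures using (IsStrictPartialOrder)
open import Relation.Nullary.Negation.Core using (¬_; contradiction)

-- Finite multisets and their well-founded extension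

module Multiset {c ℓ} (S : Setoid c ℓ) where

  private module ≈ = Setoid S
  open ≈ using () renaming (Carrier to A)
  open Membership S using (_∈_)
  open Membershipₚ using (∈-∃++)
  open Permutation S using (_↭_; ↭-refl; ↭-sym; ↭-trans; ↭-prep; ↭-swap; refl; prep)
  open Permutationₚ S

  ∈⇒↭∷ : ∀ {x xs} → x ∈ xs → ∃[ ys ] (xs ↭ x ∷ ys)
  ∈⇒↭∷ x∈xs with ps , qs , _ , x≈w , xs≋ ← ∈-∃++ S x∈xs =
    ps ++ qs , ↭-trans (refl xs≋) (shift (≈.sym x≈w) ps qs)

  ∷-↭-++ : ∀ {x xs ys zs} → x ∷ xs ↭ ys ++ zs → x ∈ ys →
           ∃[ ys′ ] ys ↭ x ∷ ys′ × (xs ↭ ys′ ++ zs)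
  ∷-↭-++ {zs = zs} p x∈ys with ys′ , q ← ∈⇒↭∷ x∈ys =
    ys′ , q , drop-∷ (↭-trans p (++⁺ʳ zs q))

  -- One step of the multiset order, on lists read up to permutation: a single
  -- element is replaced by a finite list of smaller ones.
  data MultisetStep {r} (_>_ : Rel A r) : Rel (List A) (c ⊔ ℓ ⊔ r) where
    replace : ∀ {xs ys a rest bs} → xs ↭ a ∷ rest → ys ↭ bs ++ rest →
              (∀ {b} → b ∈ bs → a > b) → MultisetStep _>_ xs ys

  module _ {r} {_>_ : Rel A r} where

    step-respˡ-↭ : ∀ {xs xs′ ys} → xs ↭ xs′ → MultisetStep _>_ xs ys →
                   MultisetStep _>_ xs′ ys
    step-respˡ-↭ p (replace q q′ h) = replace (↭-trans (↭-sym p) q) q′ h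

    step-respʳ-↭ : ∀ {xs ys ys′} → ys ↭ ys′ → MultisetStep _>_ xs ys →
                   MultisetStep _>_ xs ys′
    step-respʳ-↭ p (replace q q′ h) = replace q (↭-trans (↭-sym p) q′) h

    -- The list, read as a multiset, is accessible for these steps.
    AccMultiset : List A → Set (c ⊔ ℓ ⊔ r)
    AccMultiset = Acc (flip (MultisetStep _>_))

    AccMultiset-resp-↭ : AccMultiset Respects _↭_
    AccMultiset-resp-↭ p (acc rs) = acc λ s → rs (step-respˡ-↭ (↭-sym p) s)

    ++-acc : ∀ {bs} → (∀ {b} → b ∈ bs → ∀ {xs} → AccMultiset xs → AccMultiset (b ∷ xs)) →
             ∀ {xs} → AccMultiset xs → AccMultiset (bs ++ xs)
    ++-acc {[]}     h a = a
    ++-acc {b ∷ bs} h a = h (here ≈.refl) (++-acc (h ∘ there) a)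

    module _ (>-respˡ : _>_ Respectsˡ ≈._≈_) where

      -- A step from x ∷ xs either replaces x by smaller elements or is a step
      -- in xs; the first and the third argument are the induction hypotheses for
      -- these two cases.
      ∷-step-acc : ∀ {x xs ys} →
                   (∀ {y} → x > y → ∀ {zs} → AccMultiset zs → AccMultiset (y ∷ zs)) →
                   AccMultiset xs →
                   (∀ {zs} → MultisetStep _>_ xs zs → AccMultiset (x ∷ zs)) →
                   MultisetStep _>_ (x ∷ xs) ys → AccMultiset ys
      ∷-step-acc {x} {xs} ih-x accXs ih-xs (replace {a = a} {rest} {bs} p q h)
        with ∈-resp-↭ p (here ≈.refl)
      ... | here x≈a =
        AccMultiset-resp-↭
          (↭-sym (↭-trans q (++⁺ˡ bs (↭-sym xs↭rest))))
          (++-acc (λ b∈bs → ih-x (>-respˡ (≈.sym x≈a) (h b∈bs))) accXs)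
        where
        xs↭rest : xs ↭ rest
        xs↭rest = drop-∷ (↭-trans p (prep (≈.sym x≈a) ↭-refl))
      ... | there x∈rest with zs , rest↭x∷zs ← ∈⇒↭∷ x∈rest =
        AccMultiset-resp-↭
          (↭-sym (↭-trans q (↭-trans (++⁺ˡ bs rest↭x∷zs) (↭-shift bs zs))))
          (ih-xs (replace xs↭a∷zs ↭-refl h))
        where
        xs↭a∷zs : xs ↭ a ∷ zs
        xs↭a∷zs = drop-∷ (↭-trans p (↭-trans (↭-prep a rest↭x∷zs) (↭-swap a x ↭-refl)))

      ∷-acc : ∀ {x xs} → Acc (flip _>_) x → AccMultiset xs → AccMultiset (x ∷ xs)
      ∷-acc (acc rx) (acc rxs) =
        acc (∷-step-acc (λ x>y → ∷-acc (rx x>y)) (acc rxs) (λ s → ∷-acc (acc rx) (rxs s)))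

      ∈-acc⇒acc : ∀ {xs} → (∀ {x} → x ∈ xs → Acc (flip _>_) x) → AccMultiset xs
      ∈-acc⇒acc {[]}     h = acc λ { (replace p _ _) → contradiction (↭-sym p) ¬x∷xs↭[] }
      ∈-acc⇒acc {x ∷ xs} h = ∷-acc (h (here ≈.refl)) (∈-acc⇒acc (h ∘ there))

-- Unordered trees

module _ {a} {A : Set a} where

  -- Membership and permutation of lists of trees are both taken up to ≈.
  treeSetoid : Setoid a a
  treeSetoid = record { isEquivalence = ≈-isEquivalence {A = A} }

  open Membership treeSetoid public using (_∈_)
  open Permutation treeSetoid public using (_↭_; ↭-refl; ↭-sym; ↭-trans)
  open Permutationₚ treeSetoid public using (∈-resp-↭; ++⁺ˡ; ++-assoc)
  open Multiset treeSetoid public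

  ∈-++⁻ : ∀ {t : Tree A} ts {us} → t ∈ ts ++ us → t ∈ ts ⊎ t ∈ us
  ∈-++⁻ = Membershipₚ.∈-++⁻ treeSetoid

-- The multiset path order

module PathOrder {a b ℓ} {A : Set a} {S : Set b} (f : A → S) (_<_ : Rel S ℓ) where

  infix 4 _≻_

  -- Labels are compared through f; those with the same image count as equal.
  -- The usual clause deriving s ≻ t from a child of s that equals or dominates
  -- t is left out, so ≻ need not be transitive.
  data _≻_ : Rel (Tree A) (a ⊔ b ⊔ ℓ) where
    lower : ∀ {n m ts us} → f m < f n → (∀ {u} → u ∈ us → node n ts ≻ u) →
            node n ts ≻ node m us
    equal : ∀ {n m ts us} → f m ≡ f n → MultisetStep _≻_ ts us →
            node n ts ≻ node m us

  ≻-respˡ : _≻_ Respectsˡ _≈_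
  ≻-respˡ (node refl p) (lower m<n h) = lower m<n (λ u∈us → ≻-respˡ (node refl p) (h u∈us))
  ≻-respˡ (node refl p) (equal m≡n s) = equal m≡n (step-respˡ-↭ p s)

  ≻-respʳ : _≻_ Respectsʳ _≈_
  ≻-respʳ (node refl p) (lower m<n h) = lower m<n (h ∘ ∈-resp-↭ (↭-sym p))
  ≻-respʳ (node refl p) (equal m≡n s) = equal m≡n (step-respʳ-↭ p s)

  ≻-relabel : ∀ {t n m us} → f m ≡ f n → t ≻ node n us → t ≻ node m us
  ≻-relabel m≡n (lower {n = k} n<k h) = lower (subst (_< f k) (sym m≡n) n<k) h
  ≻-relabel m≡n (equal n≡k s) = equal (trans m≡n n≡k) s

  ≻-child : ∀ {n t u ts} → t ≻ u → node n (t ∷ ts) ≻ node n (u ∷ ts)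
  ≻-child {u = u} t≻u =
    equal refl (replace {bs = u ∷ []} ↭-refl ↭-refl λ { (here v≈u) → ≻-respʳ (≈-sym v≈u) t≻u })

  -- Accessibility when the trees below a tree are those that it dominates.
  Accessible : Tree A → Set (a ⊔ b ⊔ ℓ)
  Accessible = Acc (flip _≻_)

  Accessible-resp-≈ : Accessible Respects _≈_
  Accessible-resp-≈ = Acc-resp-flip-≈ (λ t≈u → ≻-respˡ (≈-sym t≈u))

  -- By induction on the derivation of node n ts ≻ u.  The first two arguments
  -- are the induction hypotheses for a smaller root label and for a smaller
  -- multiset of children.
  dominated-acc : ∀ {n ts u} →
    (∀ {m us} → f m < f n → (∀ {v} → v ∈ us → Accessible v) → Accessible (node m us)) →
    (∀ {m us} → f m ≡ f n → MultisetStep _≻_ ts us → (∀ {v} → v ∈ us → Accessible v) →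
      Accessible (node m us)) →
    (∀ {t} → t ∈ ts → Accessible t) → node n ts ≻ u → Accessible u
  dominated-acc ih-label ih-children accTs (lower m<n h) =
    ih-label m<n (λ u∈us → dominated-acc ih-label ih-children accTs (h u∈us))
  dominated-acc ih-label ih-children accTs (equal m≡n s@(replace {bs = bs} p q h)) =
    ih-children m≡n s λ u∈us →
      [ (λ u∈bs → acc-inverse (accTs (∈-resp-↭ (↭-sym p) (here ≈-refl))) (h u∈bs))
      , (λ u∈rest → accTs (∈-resp-↭ (↭-sym p) (there u∈rest)))
      ]′ (∈-++⁻ bs (∈-resp-↭ q u∈us))

  -- Lexicographic induction on the root label and the multiset of children.
  node-acc : ∀ {n s ts} → Acc _<_ s → s ≡ f n → AccMultiset {_>_ = _≻_} ts →
             (∀ {t} → t ∈ ts → Accessible t) → Accessible (node n ts)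
  node-acc (acc rs) refl (acc rts) accTs = acc (dominated-acc
    (λ m<n accUs → node-acc (rs m<n) refl (∈-acc⇒acc ≻-respˡ accUs) accUs)
    (λ m≡n s accUs → node-acc (acc rs) (sym m≡n) (rts s) accUs)
    accTs)

  module _ (<-wf : WellFounded _<_) where

    mutual
      ≻-wellFounded : WellFounded (flip _≻_)
      ≻-wellFounded (node n ts) =
        node-acc (<-wf (f n)) refl (∈-acc⇒acc ≻-respˡ (forest-acc ts)) (forest-acc ts)

      forest-acc : ∀ ts {t} → t ∈ ts → Accessible t
      forest-acc (u ∷ us) (here t≈u)   = Accessible-resp-≈ (≈-sym t≈u) (≻-wellFounded u)
      forest-acc (u ∷ us) (there t∈us) = forest-acc us t∈us

-- Marked trees

module _ {a} {S : Set a} where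

  -- The label without its mark.
  erase : Label S → S
  erase (plain s)      = s
  erase (underlined s) = s

  -- No label in the tree is underlined.
  data Unmarked : Tree (Label S) → Set a where
    unmarked : ∀ {s ts} → (∀ {t} → t ∈ ts → Unmarked t) → Unmarked (node (plain s) ts)

  Unmarked-resp-≈ : Unmarked Respects _≈_
  Unmarked-resp-≈ (node refl p) (unmarked h) = unmarked (h ∘ ∈-resp-↭ (↭-sym p))

  mutual
    mapTree-plain-unmarked : ∀ (h : Tree S) → Unmarked (mapTree plain h)
    mapTree-plain-unmarked (node s hs) = unmarked (mapForest-plain-unmarked hs)

    mapForest-plain-unmarked : ∀ (hs : List (Tree S)) {t} → t ∈ mapForest plain hs → Unmarked t
    mapForest-plain-unmarked (h ∷ hs) (here t≈h) =
      Unmarked-resp-≈ (≈-sym t≈h) (mapTree-plain-unmarked h)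
    mapForest-plain-unmarked (h ∷ hs) (there t∈hs) = mapForest-plain-unmarked hs t∈hs

  underlined-marked : ∀ {s ts} → ¬ Unmarked (node (underlined s) ts)
  underlined-marked ()

  child-marked : ∀ {x t ts} → ¬ Unmarked t → ¬ Unmarked (node x (t ∷ ts))
  child-marked ¬t (unmarked h) = ¬t (h (here ≈-refl))

-- The phases of a Star Hydra step

module Steps {a ℓ} {S : Set a} (_<_ : Rel S ℓ) (<-trans : Transitive _<_) where

  open StarHydra _<_
  open PathOrder (erase {S = S}) _<_

  AtSubtree-chop : ∀ {t u} → AtSubtree ChopRule t u → t ≻ u
  AtSubtree-chop (here (chop βs<α)) = equal refl (replace ↭-refl ↭-refl (leaf≻ βs<α))
    where
    leaf≻ : ∀ {α βs} → All (_< α) βs →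
            ∀ {t} → t ∈ map (λ β → leaf (underlined β)) βs → leaf (plain α) ≻ t
    leaf≻ (β<α ∷ _)    (here t≈β)  = ≻-respʳ (≈-sym t≈β) (lower β<α λ ())
    leaf≻ (_   ∷ βs<α) (there t∈βs) = leaf≻ βs<α t∈βs
  AtSubtree-chop (below t⟶u) = ≻-child (AtSubtree-chop t⟶u)

  -- If an unmarked s dominates a tree with a child v that is not unmarked, then
  -- v is dominated by s itself or by a child of s, since it cannot be among the
  -- children kept from s.  So v can be replaced by any list vs of trees that
  -- are dominated by every unmarked tree that dominates v.
  replace-child : ∀ {s x v ts} vs → Unmarked s → ¬ Unmarked v →
                  (∀ {t} → Unmarked t → t ≻ v → ∀ {w} → w ∈ vs → t ≻ w) →
                  s ≻ node x (v ∷ ts) → s ≻ node x (vs ++ ts)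
  replace-child vs s-unmarked v-marked v↝vs (lower x<n h) =
    lower x<n λ w∈ →
      [ v↝vs s-unmarked (h (here ≈-refl)) , h ∘ there ]′ (∈-++⁻ vs w∈)
  replace-child {v = v} {ts} vs (unmarked ss-unmarked) v-marked v↝vs
                (equal x≡n (replace {a = c} {rest} {bs} p q h)) =
    equal x≡n ([ (λ v∈bs → replace-in-bs (h v∈bs) (∷-↭-++ q v∈bs))
               , (λ v∈rest → contradiction (child-unmarked (there v∈rest)) v-marked)
               ]′ (∈-++⁻ bs (∈-resp-↭ q (here ≈-refl))))
    where
    child-unmarked : ∀ {t} → t ∈ c ∷ rest → Unmarked t
    child-unmarked t∈ = ss-unmarked (∈-resp-↭ (↭-sym p) t∈)

    replace-in-bs : c ≻ v → ∃[ bs′ ] bs ↭ v ∷ bs′ × ts ↭ bs′ ++ rest →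
                    MultisetStep _≻_ _ (vs ++ ts)
    replace-in-bs c≻v (bs′ , bs↭v∷bs′ , ts↭) =
      replace p (↭-trans (++⁺ˡ vs ts↭) (↭-sym (++-assoc vs bs′ rest))) λ w∈ →
        [ v↝vs (child-unmarked (here ≈-refl)) c≻v
        , (λ w∈bs′ → h (∈-resp-↭ (↭-sym bs↭v∷bs′) (there w∈bs′)))
        ]′ (∈-++⁻ vs w∈)

  -- Rewriting with R keeps a tree below every unmarked tree that it is below.
  Preserving : ∀ {r} → Rel (Tree (Label S)) r → Set (a ⊔ ℓ ⊔ r)
  Preserving R = ∀ {s t u} → Unmarked s → s ≻ t → R t u → s ≻ u

  -- R rewrites only trees that contain an underlined label.
  MarkedSource : ∀ {r} → Rel (Tree (Label S)) r → Set (a ⊔ r)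
  MarkedSource R = ∀ {t u} → R t u → ¬ Unmarked t

  module _ {r} {R : Rel (Tree (Label S)) r} where

    AtSubtree-markedSource : MarkedSource R → MarkedSource (AtSubtree R)
    AtSubtree-markedSource marked (here t⟶u)  = marked t⟶u
    AtSubtree-markedSource marked (below t⟶u) =
      child-marked (AtSubtree-markedSource marked t⟶u)

    AtSubtree-preserving : MarkedSource R → Preserving R → Preserving (AtSubtree R)
    AtSubtree-preserving marked pres s-unmarked s≻t (here t⟶u) = pres s-unmarked s≻t t⟶u
    AtSubtree-preserving marked pres s-unmarked s≻t (below {u = u} t⟶u) =
      replace-child (u ∷ []) s-unmarked (AtSubtree-markedSource marked t⟶u)
        (λ { t-unmarked t≻v (here w≈u) →
               ≻-respʳ (≈-sym w≈u) (AtSubtree-preserving marked pres t-unmarked t≻v t⟶u) })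
        s≻t

    Rewrite-preserving : MarkedSource R → Preserving R → Preserving (Rewrite R)
    Rewrite-preserving marked pres s-unmarked s≻t (_ , t≈t′ , _ , t′⟶u′ , u′≈u) =
      ≻-respʳ u′≈u (AtSubtree-preserving marked pres s-unmarked (≻-respʳ t≈t′ s≻t) t′⟶u′)

    Star-preserving : Preserving R → Preserving (Star R)
    Star-preserving pres s-unmarked s≻t ε              = s≻t
    Star-preserving pres s-unmarked s≻t (t⟶u ◅ u⟶*v) =
      Star-preserving pres s-unmarked (pres s-unmarked s≻t t⟶u) u⟶*v

    Reduce-preserving : Preserving R → Preserving (Reduce R)
    Reduce-preserving pres s-unmarked s≻t (_ , t⟶*u , u≈v) =
      ≻-respʳ u≈v (Star-preserving pres s-unmarked s≻t t⟶*u)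

  propagate-preserving : Preserving (Rewrite PropagateRule)
  propagate-preserving = Rewrite-preserving
    (λ { propagate → child-marked underlined-marked })
    (λ { _ s≻t propagate → ≻-relabel refl s≻t })

  waive-preserving : Preserving (Rewrite WaiveRule)
  waive-preserving = Rewrite-preserving
    (λ { waive → underlined-marked })
    (λ { _ s≻t waive → ≻-relabel refl s≻t })

  widen-preserving : Preserving (Rewrite WidenRule)
  widen-preserving = Rewrite-preserving
    (λ { (widen _) → underlined-marked })
    (λ { s-unmarked s≻t (widen k) →
         replace-child (replicate k _) s-unmarked underlined-marked (λ _ → copies k) s≻t })
    where
    copies : ∀ k {t v} → t ≻ v → ∀ {w} → w ∈ replicate k v → t ≻ w
    copies (suc k) t≻v (here w≈v) = ≻-respʳ (≈-sym w≈v) t≻v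
    copies (suc k) t≻v (there w∈) = copies k t≻v w∈

  lengthen-preserving : Preserving (Rewrite LengthenRule)
  lengthen-preserving = Rewrite-preserving
    (λ { (lengthen _) → underlined-marked })
    (λ { _ s≻t (lengthen m<n) → under m<n s≻t })
    where
    under : ∀ {s n m ts} → m < n → s ≻ node (underlined n) ts →
            s ≻ node (underlined m) (node (underlined n) ts ∷ [])
    under m<n s≻t@(lower n<k _) =
      lower (<-trans m<n n<k) λ { (here w≈) → ≻-respʳ (≈-sym w≈) s≻t }
    under m<n s≻t@(equal refl _) = lower m<n λ { (here w≈) → ≻-respʳ (≈-sym w≈) s≻t }

  -- Maximality of the propagate and waive phases plays no role: a final tree of
  -- the form mapTree plain h′ is compared with h in any case.
  ⟶SH⇒≻ : ∀ {h h′} → h ⟶SH h′ → mapTree plain h ≻ mapTree plain h′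
  ⟶SH⇒≻ {h} (_ , (_ , h≈t , _ , t⟶u , u≈v) , _ , (propagates , _) , _ , grows , waives , _) =
    Reduce-preserving waive-preserving s-unmarked
      (Reduce-preserving widen∪lengthen-preserving s-unmarked
        (Reduce-preserving propagate-preserving s-unmarked
          (≻-respˡ (≈-sym h≈t) (≻-respʳ u≈v (AtSubtree-chop t⟶u)))
          propagates)
        grows)
      waives
    where
    s-unmarked : Unmarked (mapTree plain h)
    s-unmarked = mapTree-plain-unmarked h

    widen∪lengthen-preserving : Preserving _
    widen∪lengthen-preserving s-unm s≻t =
      [ widen-preserving s-unm s≻t , lengthen-preserving s-unm s≻t ]′

acc⇒no-descent : ∀ {a ℓ} {A : Set a} {_<_ : Rel A ℓ} {x} → Acc _<_ x →
                 (g : ℕ → A) → g 0 ≡ x → ¬ (∀ i → g (suc i) < g i)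
acc⇒no-descent (acc rs) g refl g↓ = acc⇒no-descent (rs (g↓ 0)) (g ∘ suc) refl (g↓ ∘ suc)

theorem6p18 : ∀ {a ℓ} {S : Set a} (_<_ : Rel S ℓ) →
    IsStrictPartialOrder _≡_ _<_ → WellFounded _<_ →
    let open StarHydra _<_ in
    ¬ (Σ[ h ∈ (ℕ → Tree S) ] ((i : ℕ) → h i ⟶SH h (suc i)))
theorem6p18 _<_ <-spo <-wf (h , h⟶) =
  acc⇒no-descent (≻-wellFounded <-wf (mapTree plain (h 0)))
    (mapTree plain ∘ h) refl (λ i → ⟶SH⇒≻ (h⟶ i))
  where
  open PathOrder erase _<_ using (≻-wellFounded)
  open Steps _<_ (IsStrictPartialOrder.trans <-spo) using (⟶SH⇒≻)
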